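{- Let $G=(V,E)$ be a finite undirected graph without self-loops, with $n=|V|$ and non-negative real edge weights $w(u,v)$, $(u,v)\in E$, and let $s_0,s_1>0$ be integers with $s_0+s_1=n$. Let $(U_0,U_1)$ be any subproblem, i.e. a pair of disjoint subsets of $V$ with $|U_i|\le s_i$ for $i=0,1$. Let $F=V\setminus(U_0\cup U_1)$ and $f_i=s_i-|U_i|$ for $i=0,1$, and suppose the two sides are named so that $f_0\ge f_1$. Let $G'$ be the subgraph of $G$ induced by $F$. Let $C(U_0,U_1)$ be either (a) the sum of the weights of the $k$ lightest edges of a $k$-connected component of $G'$ having more than $f_0$ vertices, for some integer $k\ge1$ for which such a component exists; or (b) the value of a (size-unconstrained) minimum cut of a connected component of $G'$ having more than $f_0$ vertices, if such a component exists. Then, in either case, for every completion $(V_0,V_1)$ of $(U_0,U_1)$, $$C(U_0,U_1)\le w(V_0\setminus U_0,V_1\setminus U_1).$$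
   Context: For disjoint subsets $A,B\subseteq V$, $w(A,B)=\sum_{(u,v)\in E,\ u\in A,\ v\in B}w(u,v)$ is the total weight of the edges with one endpoint in $A$ and the other in $B$. A completion of a subproblem $(U_0,U_1)$ is a partition $(V_0,V_1)$ of $V$ with $|V_0|=s_0$, $|V_1|=s_1$ and $U_i\subseteq V_i$ for $i=0,1$. A $k$-connected component of a graph is a maximal $k$-connected subgraph (where a $k$-connected graph has more than $k$ vertices and remains connected after deletion of any fewer than $k$ vertices). The value of a size-unconstrained minimum cut of a connected graph $H$ with vertex set $W$, $|W|\ge2$, is the minimum, over all partitions of $W$ into two non-empty sets $A,B$, of the total weight of the edges of $H$ between $A$ and $B$. Graphs are simple (at most one edge between two vertices). -}

module Defs where

open import Data.Nat as ℕ using (ℕ; _⊔_)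
import Data.Nat.Properties as ℕ
open import Data.Rational as ℚ using (ℚ; 0ℚ; ½; ∣_∣)
import Data.Rational.Properties as ℚ
open import Data.Rational.Solver using (module +-*-Solver)
open import Data.Fin using (Fin; _<_)
open import Data.Fin.Properties using (_<?_)
open import Data.Fin.Subset as Subset using
  (Subset; _∈_; _⊆_; _∪_; _∩_; ∁; Nonempty; Empty)
open import Data.Fin.Subset.Properties using (_∈?_; x∈p∩q⁺)
open import Data.List using (List; map; foldr; filter; length; allFin; cartesianProduct; _++_)
open import Data.List.Relation.Unary.All using (All)
open import Data.List.Relation.Binary.Permutation.Propositional using (_↭_)
open import Data.Product using (_×_; _,_; ∃₂; ∃-syntax; uncurry)
open import Relation.Binary.Construct.Closure.ReflexiveTransitive using (Star)
open import Relation.Binary.Definitions using (Decidable)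
open import Relation.Binary.PropositionalEquality using (_≡_; refl; sym; trans; subst₂; cong)
open import Relation.Nullary using (¬_)
open import Relation.Nullary.Decidable using (_×-dec_)

------------------------------------------------------------------------
-- Real numbers: Cauchy sequences of rationals, with equality _≈ℝ_

record ℝ : Set where
  constructor mkℝ
  field
    seq    : ℕ → ℚ
    cauchy : ∀ ε → 0ℚ ℚ.< ε →
             ∃[ M ] (∀ i j → M ℕ.≤ i → M ℕ.≤ j → ∣ seq i ℚ.- seq j ∣ ℚ.≤ ε)

open ℝ public

infix  4 _≤ℝ_ _≈ℝ_
infixl 6 _+ℝ_

_≤ℝ_ : ℝ → ℝ → Set
x ≤ℝ y = ∀ ε → 0ℚ ℚ.< ε → ∃[ M ] (∀ i → M ℕ.≤ i → seq x i ℚ.≤ seq y i ℚ.+ ε)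

_≈ℝ_ : ℝ → ℝ → Set
x ≈ℝ y = x ≤ℝ y × y ≤ℝ x

0ℝ : ℝ
0ℝ = mkℝ (λ _ → 0ℚ) (λ ε 0<ε → 0 , λ _ _ _ _ → ℚ.<⇒≤ 0<ε)

_+ℝ_ : ℝ → ℝ → ℝ
x +ℝ y = mkℝ (λ i → seq x i ℚ.+ seq y i) cauchy-+
  where
  regroup : ∀ a b c d → (a ℚ.- c) ℚ.+ (b ℚ.- d) ≡ (a ℚ.+ b) ℚ.- (c ℚ.+ d)
  regroup = solve 4 (λ a b c d → (a :- c) :+ (b :- d) := (a :+ b) :- (c :+ d)) refl
    where open +-*-Solver

  ½+½ : ∀ ε → ½ ℚ.* ε ℚ.+ ½ ℚ.* ε ≡ ε
  ½+½ ε = trans (sym (ℚ.*-distribʳ-+ ε ½ ½)) (ℚ.*-identityˡ ε)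

  cauchy-+ : ∀ ε → 0ℚ ℚ.< ε → ∃[ M ] (∀ i j → M ℕ.≤ i → M ℕ.≤ j →
             ∣ (seq x i ℚ.+ seq y i) ℚ.- (seq x j ℚ.+ seq y j) ∣ ℚ.≤ ε)
  cauchy-+ ε 0<ε with cauchy x (½ ℚ.* ε) (ℚ.*-monoʳ-<-pos ½ 0<ε)
                    | cauchy y (½ ℚ.* ε) (ℚ.*-monoʳ-<-pos ½ 0<ε)
  ... | M , p | M′ , q = M ⊔ M′ , λ i j i≥ j≥ →
    subst₂ ℚ._≤_
      (cong ∣_∣ (regroup (seq x i) (seq y i) (seq x j) (seq y j)))
      (½+½ ε)
      (ℚ.≤-trans
        (ℚ.∣p+q∣≤∣p∣+∣q∣ (seq x i ℚ.- seq x j) (seq y i ℚ.- seq y j))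
        (ℚ.+-mono-≤
          (p i j (ℕ.m⊔n≤o⇒m≤o M M′ i≥) (ℕ.m⊔n≤o⇒m≤o M M′ j≥))
          (q i j (ℕ.m⊔n≤o⇒n≤o M M′ i≥) (ℕ.m⊔n≤o⇒n≤o M M′ j≥))))

sumℝ : List ℝ → ℝ
sumℝ = foldr _+ℝ_ 0ℝ

------------------------------------------------------------------------
-- Finite simple graphs

-- The vertex set V is an arbitrary subset of Fin N, so that a graph and its
-- subgraphs are objects of the same type.
record Graph (N : ℕ) : Set₁ where
  field
    V      : Subset N
    Adj    : Fin N → Fin N → Set
    adj?   : Decidable Adj
    symm   : ∀ {u v} → Adj u v → Adj v u
    irrefl : ∀ {v} → ¬ Adj v v
    adj∈V  : ∀ {u v} → Adj u v → u ∈ V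

open Graph public

module _ {N : ℕ} where

  infixl 8 _[_]
  infix  4 _⊑_

  _[_] : Graph N → Subset N → Graph N
  G [ S ] = record
    { V      = V G ∩ S
    ; Adj    = λ u v → Adj G u v × u ∈ S × v ∈ S
    ; adj?   = λ u v → adj? G u v ×-dec (u ∈? S) ×-dec (v ∈? S)
    ; symm   = λ (e , p , q) → symm G e , q , p
    ; irrefl = λ (e , _) → irrefl G e
    ; adj∈V  = λ (e , p , _) → x∈p∩q⁺ (adj∈V G e , p)
    }

  _⊑_ : Graph N → Graph N → Set
  H ⊑ G = V H ⊆ V G × (∀ {u v} → Adj H u v → Adj G u v)

  Connected : Graph N → Set
  Connected H = Nonempty (V H) × (∀ {u v} → u ∈ V H → v ∈ V H → Star (Adj H) u v)

  KConnected : ℕ → Graph N → Set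
  KConnected k H =
    k ℕ.< Subset.∣ V H ∣ ×
    (∀ X → X ⊆ V H → Subset.∣ X ∣ ℕ.< k → Connected (H [ ∁ X ]))

  -- H is maximal among the subgraphs of G satisfying P.
  MaximalSubgraph : (Graph N → Set) → Graph N → Graph N → Set₁
  MaximalSubgraph P H G =
    H ⊑ G × P H × (∀ H′ → H′ ⊑ G → P H′ → H ⊑ H′ → H′ ⊑ H)

  IsComponent : Graph N → Graph N → Set₁
  IsComponent = MaximalSubgraph Connected

  IsKComponent : ℕ → Graph N → Graph N → Set₁
  IsKComponent k = MaximalSubgraph (KConnected k)

  Disjoint : Subset N → Subset N → Set
  Disjoint A B = Empty (A ∩ B)

  IsPartition : Subset N → Subset N → Subset N → Set
  IsPartition W A B = A ∪ B ≡ W × Disjoint A B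

------------------------------------------------------------------------
-- Edge weights

  Weight : Set
  Weight = Fin N → Fin N → ℝ

  -- Values of the weight function outside the edges are irrelevant.
  record IsWeighting (G : Graph N) (w : Weight) : Set where
    field
      w-sym  : ∀ {u v} → Adj G u v → w u v ≈ℝ w v u
      w-nneg : ∀ {u v} → Adj G u v → 0ℝ ≤ℝ w u v

  pairs : List (Fin N × Fin N)
  pairs = cartesianProduct (allFin N) (allFin N)

  -- Each undirected edge is listed once, with its smaller endpoint first.
  edges : Graph N → List (Fin N × Fin N)
  edges H = filter (λ (u , v) → (u <? v) ×-dec adj? H u v) pairs

  totalWeight : Weight → List (Fin N × Fin N) → ℝ
  totalWeight w es = sumℝ (map (uncurry w) es)

  -- w(A,B) in the graph H; each edge is counted once when A and B are disjoint.
  cutWeight : Graph N → Weight → Subset N → Subset N → ℝ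
  cutWeight H w A B =
    totalWeight w (filter (λ (u , v) → (u ∈? A) ×-dec (v ∈? B) ×-dec adj? H u v) pairs)

  -- The edges of H split into k edges and the rest, none of the former being
  -- heavier than any of the latter.  The sum does not depend on how ties are
  -- broken.
  IsSumOfLightest : ℕ → Graph N → Weight → ℝ → Set
  IsSumOfLightest k H w c = ∃₂ λ light rest →
    light ++ rest ↭ edges H ×
    length light ≡ k ×
    All (λ e → All (λ f → uncurry w e ≤ℝ uncurry w f) rest) light ×
    c ≈ℝ totalWeight w light

  IsCut : Graph N → Subset N → Subset N → Set
  IsCut H A B = IsPartition (V H) A B × Nonempty A × Nonempty B

  IsMinCutValue : Graph N → Weight → ℝ → Set
  IsMinCutValue H w c =
    (∃₂ λ A B → IsCut H A B × c ≈ℝ cutWeight H w A B) ×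
    (∀ A B → IsCut H A B → c ≤ℝ cutWeight H w A B)

------------------------------------------------------------------------
-- Subproblems and completions

  record IsSubproblem (G : Graph N) (s₀ s₁ : ℕ) (U₀ U₁ : Subset N) : Set where
    field
      U₀⊆V     : U₀ ⊆ V G
      U₁⊆V     : U₁ ⊆ V G
      disjoint : Disjoint U₀ U₁
      ∣U₀∣≤s₀  : Subset.∣ U₀ ∣ ℕ.≤ s₀
      ∣U₁∣≤s₁  : Subset.∣ U₁ ∣ ℕ.≤ s₁

  record IsCompletion (G : Graph N) (s₀ s₁ : ℕ) (U₀ U₁ V₀ V₁ : Subset N) : Set where
    field
      partition : IsPartition (V G) V₀ V₁
      ∣V₀∣≡s₀   : Subset.∣ V₀ ∣ ≡ s₀
      ∣V₁∣≡s₁   : Subset.∣ V₁ ∣ ≡ s₁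
      U₀⊆V₀     : U₀ ⊆ V₀
      U₁⊆V₁     : U₁ ⊆ V₁

-- The component H of G′ has more than f₀ ≥ f₁ vertices, so it meets both
-- V₀ ∖ U₀ and V₁ ∖ U₁, and these sets induce a cut of H all of whose edges are
-- counted in w(V₀ ∖ U₀, V₁ ∖ U₁).  This settles (b).  For (a), a cut of a
-- k-connected graph has at least k edges: if some a ∈ A and b ∈ B are not
-- adjacent, deleting from each cut edge an endpoint other than a and b separates
-- a from b; otherwise, endpoints other than a of the cut edges exhaust the
-- vertices other than a.  So the k lightest edges weigh no more than the cut.
module Submission where

open import Defs
open import Data.Nat using (ℕ; _+_; _∸_; _≤_; _<_; _⊔_; suc; z≤n; s≤s)
import Data.Nat.Properties as ℕ
open import Data.Rational as ℚ using (½)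
import Data.Rational.Properties as ℚ
open import Data.Rational.Solver using (module +-*-Solver)
open import Data.Bool using (if_then_else_)
open import Data.Fin as Fin using (Fin)
import Data.Fin.Properties as Fin
open import Data.Fin.Subset using
  (Subset; ∣_∣; _∪_; _∩_; _─_; ∁; ⋃; ⁅_⁆; _∈_; _∉_; _⊆_; Nonempty; inside; outside)
open import Data.Fin.Subset.Properties using
  ( _∈?_; nonempty?; ⊆-antisym; drop-∷-⊆; p⊆q⇒∣p∣≤∣q∣; ∣⊥∣≡0; ∣⁅x⁆∣≡1; x∈⁅x⁆; x∈⁅y⁆⇒x≡y; ∉⊥
  ; ∪-comm; ∩-distribˡ-∪; p∩q⊆p; p∩q⊆q; x∈p∩q⁺; x∈p∩q⁻; x∈p∪q⁺; x∈p∪q⁻; p─q⊆p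
  ; x∈p∧x∉q⇒x∈p─q; x∈∁p⇒x∉p; x∉p⇒x∈∁p )
open import Data.List using (List; []; _∷_; _++_; map; filter; length)
open import Data.List.Properties using (map-∘; map-id-local; length-map)
open import Data.List.Membership.Propositional using (find) renaming (_∈_ to _∈ᴸ_; _∉_ to _∉ᴸ_)
open import Data.List.Membership.Propositional.Properties using
  (∈-∃++; ∈-++⁻; ∈-allFin; ∈-cartesianProduct⁺; ∈-filter⁺; ∈-filter⁻; ∈-map⁺; ∈-map⁻)
import Data.List.Membership.DecPropositional as DecMembership
open import Data.List.Relation.Unary.All as All using (All; []; _∷_)
open import Data.List.Relation.Unary.All.Properties using (¬All⇒Any¬)
open import Data.List.Relation.Unary.AllPairs using ([]; _∷_)
open import Data.List.Relation.Unary.Any using (here; there)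
open import Data.List.Relation.Unary.Unique.Propositional using (Unique)
import Data.List.Relation.Unary.Unique.Propositional.Properties as Unique
open import Data.List.Relation.Binary.Permutation.Propositional using
  (_↭_; refl; prep; swap; trans; ↭-sym; ↭⇒↭ₛ)
open import Data.List.Relation.Binary.Permutation.Propositional.Properties using
  (∈-resp-↭; ↭-length; shift)
import Data.List.Relation.Binary.Permutation.Setoid.Properties as Permutation
open import Data.List.Relation.Binary.Sublist.Propositional using
  ([]; _∷_; _∷ʳ_; ⊆-refl) renaming (_⊆_ to _⊑ˢ_)
import Data.List.Relation.Binary.Sublist.Propositional.Properties as Sublist
open import Data.Product using (_×_; _,_; proj₁; proj₂; ∃-syntax; ∃₂; uncurry)
import Data.Product.Properties as Product
open import Data.Sum using (_⊎_; inj₁; inj₂; [_,_]′)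
open import Data.Vec using ([]; _∷_; here; there)
open import Function using (_∘_)
open import Relation.Binary.Construct.Closure.ReflexiveTransitive using (Star; ε; _◅_)
open import Relation.Binary.Definitions using (DecidableEquality; tri<; tri≈; tri>)
open import Relation.Binary.PropositionalEquality as ≡
  using (_≡_; _≢_; cong; subst; sym; setoid)
open import Relation.Nullary using (¬_; Dec; yes; no; does; contradiction)
open import Relation.Nullary.Decidable using (_×-dec_; ¬?)

-- Order and addition of Cauchy reals.

-- _≤ℝ_ unfolds to a Π-type from which Agda cannot recover its arguments, so they
-- are passed explicitly throughout.
≤ℝ-reflexive : ∀ {x y} → (∀ i → seq x i ≡ seq y i) → x ≤ℝ y
≤ℝ-reflexive {x} {y} x≡y δ 0<δ = 0 , λ i _ → ℚ.≤-trans
  (ℚ.≤-reflexive (≡.trans (x≡y i) (sym (ℚ.+-identityʳ (seq y i)))))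
  (ℚ.+-monoʳ-≤ (seq y i) (ℚ.<⇒≤ 0<δ))

≤ℝ-refl : ∀ {x} → x ≤ℝ x
≤ℝ-refl {x} = ≤ℝ-reflexive {x} {x} (λ _ → ≡.refl)

½+½ : ∀ δ → ½ ℚ.* δ ℚ.+ ½ ℚ.* δ ≡ δ
½+½ δ = ≡.trans (sym (ℚ.*-distribʳ-+ δ ½ ½)) (ℚ.*-identityˡ δ)

≤ℝ-trans : ∀ {x y z} → x ≤ℝ y → y ≤ℝ z → x ≤ℝ z
≤ℝ-trans {x} {y} {z} x≤y y≤z δ 0<δ
  with x≤y (½ ℚ.* δ) (ℚ.*-monoʳ-<-pos ½ 0<δ) | y≤z (½ ℚ.* δ) (ℚ.*-monoʳ-<-pos ½ 0<δ)
... | M , p | M′ , q = M ⊔ M′ , λ i i≥ → begin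
  seq x i                                    ≤⟨ p i (ℕ.m⊔n≤o⇒m≤o M M′ i≥) ⟩
  seq y i ℚ.+ ½ ℚ.* δ                        ≤⟨ ℚ.+-monoˡ-≤ _ (q i (ℕ.m⊔n≤o⇒n≤o M M′ i≥)) ⟩
  seq z i ℚ.+ ½ ℚ.* δ ℚ.+ ½ ℚ.* δ            ≡⟨ ℚ.+-assoc (seq z i) _ _ ⟩
  seq z i ℚ.+ (½ ℚ.* δ ℚ.+ ½ ℚ.* δ)          ≡⟨ cong (seq z i ℚ.+_) (½+½ δ) ⟩
  seq z i ℚ.+ δ                              ∎
  where open ℚ.≤-Reasoning

+ℝ-mono-≤ : ∀ {x x′ y y′} → x ≤ℝ x′ → y ≤ℝ y′ → x +ℝ y ≤ℝ x′ +ℝ y′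
+ℝ-mono-≤ {x} {x′} {y} {y′} x≤x′ y≤y′ δ 0<δ
  with x≤x′ (½ ℚ.* δ) (ℚ.*-monoʳ-<-pos ½ 0<δ) | y≤y′ (½ ℚ.* δ) (ℚ.*-monoʳ-<-pos ½ 0<δ)
... | M , p | M′ , q = M ⊔ M′ , λ i i≥ → begin
  seq x i ℚ.+ seq y i
    ≤⟨ ℚ.+-mono-≤ (p i (ℕ.m⊔n≤o⇒m≤o M M′ i≥)) (q i (ℕ.m⊔n≤o⇒n≤o M M′ i≥)) ⟩
  (seq x′ i ℚ.+ ½ ℚ.* δ) ℚ.+ (seq y′ i ℚ.+ ½ ℚ.* δ)
    ≡⟨ regroup (seq x′ i) (½ ℚ.* δ) (seq y′ i) (½ ℚ.* δ) ⟩
  (seq x′ i ℚ.+ seq y′ i) ℚ.+ (½ ℚ.* δ ℚ.+ ½ ℚ.* δ)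
    ≡⟨ cong (seq x′ i ℚ.+ seq y′ i ℚ.+_) (½+½ δ) ⟩
  (seq x′ i ℚ.+ seq y′ i) ℚ.+ δ
    ∎
  where
  open ℚ.≤-Reasoning
  regroup : ∀ a b c d → (a ℚ.+ b) ℚ.+ (c ℚ.+ d) ≡ (a ℚ.+ c) ℚ.+ (b ℚ.+ d)
  regroup = solve 4 (λ a b c d → (a :+ b) :+ (c :+ d) := (a :+ c) :+ (b :+ d)) ≡.refl
    where open +-*-Solver

0≤x⇒y≤x+y : ∀ {x y} → 0ℝ ≤ℝ x → y ≤ℝ x +ℝ y
0≤x⇒y≤x+y {x} {y} 0≤x = ≤ℝ-trans {y} {0ℝ +ℝ y} {x +ℝ y}
  (≤ℝ-reflexive {y} {0ℝ +ℝ y} (λ i → sym (ℚ.+-identityˡ (seq y i))))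
  (+ℝ-mono-≤ {0ℝ} {x} {y} {y} 0≤x (≤ℝ-refl {y}))

-- Finite sums of reals.

module _ {A : Set} where

  sumOf : (A → ℝ) → List A → ℝ
  sumOf f es = sumℝ (map f es)

  sumOf-mono : ∀ {f g} es → (∀ {e} → e ∈ᴸ es → f e ≤ℝ g e) → sumOf f es ≤ℝ sumOf g es
  sumOf-mono []       f≤g = ≤ℝ-refl {0ℝ}
  sumOf-mono {f} {g} (e ∷ es) f≤g =
    +ℝ-mono-≤ {f e} {g e} {sumOf f es} {sumOf g es} (f≤g (here ≡.refl)) (sumOf-mono es (f≤g ∘ there))

  0≤sumOf : ∀ {f} es → (∀ {e} → e ∈ᴸ es → 0ℝ ≤ℝ f e) → 0ℝ ≤ℝ sumOf f es
  0≤sumOf []       0≤f = ≤ℝ-refl {0ℝ}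
  0≤sumOf {f} (e ∷ es) 0≤f = ≤ℝ-trans {0ℝ} {sumOf f es} {sumOf f (e ∷ es)}
    (0≤sumOf es (0≤f ∘ there)) (0≤x⇒y≤x+y {f e} {sumOf f es} (0≤f (here ≡.refl)))

  -- Permutations are invertible, so this one inequality yields equality of the two sums.
  sumOf-↭ : ∀ f {xs ys} → xs ↭ ys → sumOf f xs ≤ℝ sumOf f ys
  sumOf-↭ f {xs} refl = ≤ℝ-refl {sumOf f xs}
  sumOf-↭ f (prep {xs} {ys} x p) =
    +ℝ-mono-≤ {f x} {f x} {sumOf f xs} {sumOf f ys} (≤ℝ-refl {f x}) (sumOf-↭ f p)
  sumOf-↭ f (swap {xs} {ys} x y p) = ≤ℝ-trans
    {sumOf f (x ∷ y ∷ xs)} {sumOf f (y ∷ x ∷ xs)} {sumOf f (y ∷ x ∷ ys)}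
    (≤ℝ-reflexive {sumOf f (x ∷ y ∷ xs)} {sumOf f (y ∷ x ∷ xs)}
      (λ i → exchange (seq (f x) i) (seq (f y) i) (seq (sumOf f xs) i)))
    (+ℝ-mono-≤ {f y} {f y} {sumOf f (x ∷ xs)} {sumOf f (x ∷ ys)} (≤ℝ-refl {f y})
      (+ℝ-mono-≤ {f x} {f x} {sumOf f xs} {sumOf f ys} (≤ℝ-refl {f x}) (sumOf-↭ f p)))
    where
    exchange : ∀ a b c → a ℚ.+ (b ℚ.+ c) ≡ b ℚ.+ (a ℚ.+ c)
    exchange = solve 3 (λ a b c → a :+ (b :+ c) := b :+ (a :+ c)) ≡.refl
      where open +-*-Solver
  sumOf-↭ f (trans {xs} {ys} {zs} p q) =
    ≤ℝ-trans {sumOf f xs} {sumOf f ys} {sumOf f zs} (sumOf-↭ f p) (sumOf-↭ f q)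

  -- Each entry skipped by the embedding adds a non-negative term on the right.
  sumOf-sublist : ∀ f {xs ys} → xs ⊑ˢ ys → (∀ {e} → e ∈ᴸ ys → 0ℝ ≤ℝ f e) →
                  sumOf f xs ≤ℝ sumOf f ys
  sumOf-sublist f [] 0≤f = ≤ℝ-refl {0ℝ}
  sumOf-sublist f {xs} {y ∷ ys} (y ∷ʳ xs⊑ys) 0≤f =
    ≤ℝ-trans {sumOf f xs} {sumOf f ys} {sumOf f (y ∷ ys)} (sumOf-sublist f xs⊑ys (0≤f ∘ there))
      (0≤x⇒y≤x+y {f y} {sumOf f ys} (0≤f (here ≡.refl)))
  sumOf-sublist f {x ∷ xs} {x ∷ ys} (≡.refl ∷ xs⊑ys) 0≤f =
    +ℝ-mono-≤ {f x} {f x} {sumOf f xs} {sumOf f ys} (≤ℝ-refl {f x})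
      (sumOf-sublist f xs⊑ys (0≤f ∘ there))

  -- Counting and exchange in duplicate-free lists.

  extract : ∀ {e : A} {D} → e ∈ᴸ D → Unique D →
            ∃[ D′ ] (D ↭ e ∷ D′ × (∀ {x} → x ∈ᴸ D′ → e ≢ x) × Unique D′)
  extract {e} e∈D uD with ∈-∃++ e∈D
  ... | xs , ys , ≡.refl
    with Permutation.Unique-resp-↭ (setoid A) (↭⇒↭ₛ (shift e xs ys)) uD
  ...   | e∉ ∷ u = xs ++ ys , shift e xs ys , All.lookup e∉ , u

  ∈-tail : ∀ {x e : A} {xs} → e ≢ x → x ∈ᴸ e ∷ xs → x ∈ᴸ xs
  ∈-tail e≢x (here x≡e)  = contradiction (sym x≡e) e≢x
  ∈-tail e≢x (there x∈xs) = x∈xs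

  ∈-++-right : ∀ {x : A} {xs ys} → x ∉ᴸ xs → x ∈ᴸ xs ++ ys → x ∈ᴸ ys
  ∈-++-right {xs = xs} x∉xs x∈ with ∈-++⁻ xs x∈
  ... | inj₁ x∈xs = contradiction x∈xs x∉xs
  ... | inj₂ x∈ys = x∈ys

  -- Pigeonhole: strike the head of `D` from `E`; the other members of `D` differ from it and so
  -- survive in what is left of `E`.
  Unique-⊆⇒length≤ : ∀ {D E : List A} → Unique D → (∀ {x} → x ∈ᴸ D → x ∈ᴸ E) → length D ≤ length E
  Unique-⊆⇒length≤ [] D⊆E = z≤n
  Unique-⊆⇒length≤ {d ∷ D} {E} (d∉D ∷ uD) D⊆E with ∈-∃++ (D⊆E (here ≡.refl))
  ... | xs , ys , ≡.refl = subst (suc (length D) ≤_) (sym (↭-length (shift d xs ys)))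
    (s≤s (Unique-⊆⇒length≤ uD λ x∈D →
      ∈-tail (All.lookup d∉D x∈D) (∈-resp-↭ (shift d xs ys) (D⊆E (there x∈D)))))

  module _ (_≟_ : DecidableEquality A) where
    open DecMembership _≟_ using () renaming (_∈?_ to _∈ᴸ?_)

    longer⇒∃∉ : ∀ {D E : List A} → Unique D → length E < length D → ∃[ d ] (d ∈ᴸ D × d ∉ᴸ E)
    longer⇒∃∉ {D} {E} uD E<D with All.all? (_∈ᴸ? E) D
    ... | yes D⊆E = contradiction (Unique-⊆⇒length≤ uD (All.lookup D⊆E)) (ℕ.<⇒≱ E<D)
    ... | no ¬D⊆E = find (¬All⇒Any¬ (_∈ᴸ? E) D ¬D⊆E)

    -- Exchange: pair the first light e with itself if e ∈ D, and otherwise with a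
    -- member of D outside light, which exists by counting and is at least as heavy.
    lightest≤ : ∀ f light {rest D} → Unique D →
                (∀ {e} → e ∈ᴸ D → e ∈ᴸ light ++ rest) → length light ≤ length D →
                All (λ e → All (λ g → f e ≤ℝ f g) rest) light →
                (∀ {e} → e ∈ᴸ D → 0ℝ ≤ℝ f e) → sumOf f light ≤ℝ sumOf f D
    -- With `light` exhausted, `D` may still have members; non-negativity absorbs them.
    lightest≤ f [] {D = D} uD D⊆ len ord 0≤f = 0≤sumOf D 0≤f
    lightest≤ f (e ∷ l) {rest} {D} uD D⊆ len (e≤ ∷ ord) 0≤f = split (e ∈ᴸ? D)
      where
      -- Here `d` is the partner of `e`. Striking both leaves shorter lists, and the second
      -- hypothesis restores the inclusion that the induction needs.
      exchange : ∀ {d} → d ∈ᴸ D → (∀ {x} → x ∈ᴸ D → d ≢ x → x ∈ᴸ l ++ rest) → f e ≤ℝ f d →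
                 sumOf f (e ∷ l) ≤ℝ sumOf f D
      exchange {d} d∈D D∖d⊆ fe≤fd =
        let D′ , D↭ , d∉D′ , uD′ = extract d∈D uD
            ∈D : ∀ {x} → x ∈ᴸ D′ → x ∈ᴸ D
            ∈D = ∈-resp-↭ (↭-sym D↭) ∘ there
        in ≤ℝ-trans {sumOf f (e ∷ l)} {sumOf f (d ∷ D′)} {sumOf f D}
             (+ℝ-mono-≤ {f e} {f d} {sumOf f l} {sumOf f D′} fe≤fd
               (lightest≤ f l uD′
                 (λ x∈D′ → D∖d⊆ (∈D x∈D′) (d∉D′ x∈D′))
                 (ℕ.≤-pred (subst (suc (length l) ≤_) (↭-length D↭) len))
                 ord (0≤f ∘ ∈D)))
             (sumOf-↭ f (↭-sym D↭))

      split : Dec (e ∈ᴸ D) → sumOf f (e ∷ l) ≤ℝ sumOf f D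
      split (yes e∈D) = exchange e∈D (λ x∈D e≢x → ∈-tail e≢x (D⊆ x∈D)) (≤ℝ-refl {f e})
      split (no e∉D) =
        -- `len` says that the tail `l` is strictly shorter than `D`. Avoiding `l` is enough, since
        -- `e` is not in `D` anyway.
        let d , d∈D , d∉l = longer⇒∃∉ uD len
        in exchange d∈D (λ x∈D _ → D⊆l++rest x∈D) (All.lookup e≤ (∈-++-right d∉l (D⊆l++rest d∈D)))
        where
        D⊆l++rest : ∀ {x} → x ∈ᴸ D → x ∈ᴸ l ++ rest
        D⊆l++rest x∈D = ∈-tail (λ { ≡.refl → e∉D x∈D }) (D⊆ x∈D)

-- Differences, unions and sizes of finite sets.

x∈p─q⇒x∉q : ∀ {n} {x : Fin n} (p q : Subset n) → x ∈ p ─ q → x ∉ q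
x∈p─q⇒x∉q (_ ∷ p) (inside  ∷ q) (there x∈p─q) (there x∈q) = x∈p─q⇒x∉q p q x∈p─q x∈q
x∈p─q⇒x∉q (_ ∷ p) (outside ∷ q) (there x∈p─q) (there x∈q) = x∈p─q⇒x∉q p q x∈p─q x∈q

q⊆p⇒∣p─q∣≡∣p∣∸∣q∣ : ∀ {n} (p q : Subset n) → q ⊆ p → ∣ p ─ q ∣ ≡ ∣ p ∣ ∸ ∣ q ∣
q⊆p⇒∣p─q∣≡∣p∣∸∣q∣ []            []            q⊆p = ≡.refl
q⊆p⇒∣p─q∣≡∣p∣∸∣q∣ (inside  ∷ p) (inside  ∷ q) q⊆p = q⊆p⇒∣p─q∣≡∣p∣∸∣q∣ p q (drop-∷-⊆ q⊆p)
q⊆p⇒∣p─q∣≡∣p∣∸∣q∣ (outside ∷ p) (inside  ∷ q) q⊆p with () ← q⊆p here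
q⊆p⇒∣p─q∣≡∣p∣∸∣q∣ (outside ∷ p) (outside ∷ q) q⊆p = q⊆p⇒∣p─q∣≡∣p∣∸∣q∣ p q (drop-∷-⊆ q⊆p)
q⊆p⇒∣p─q∣≡∣p∣∸∣q∣ (inside  ∷ p) (outside ∷ q) q⊆p = ≡.trans
  (cong suc (q⊆p⇒∣p─q∣≡∣p∣∸∣q∣ p q (drop-∷-⊆ q⊆p)))
  -- Truncated subtraction commutes with the successor here because `∣ q ∣ ≤ ∣ p ∣`.
  (sym (ℕ.+-∸-assoc 1 (p⊆q⇒∣p∣≤∣q∣ (drop-∷-⊆ q⊆p))))

∣p∪q∣≤∣p∣+∣q∣ : ∀ {n} (p q : Subset n) → ∣ p ∪ q ∣ ≤ ∣ p ∣ + ∣ q ∣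
∣p∪q∣≤∣p∣+∣q∣ []            []            = z≤n
∣p∪q∣≤∣p∣+∣q∣ (inside  ∷ p) (inside  ∷ q) =
  s≤s (ℕ.≤-trans (∣p∪q∣≤∣p∣+∣q∣ p q) (ℕ.+-monoʳ-≤ ∣ p ∣ (ℕ.n≤1+n _)))
∣p∪q∣≤∣p∣+∣q∣ (inside  ∷ p) (outside ∷ q) = s≤s (∣p∪q∣≤∣p∣+∣q∣ p q)
∣p∪q∣≤∣p∣+∣q∣ (outside ∷ p) (inside  ∷ q) =
  ℕ.≤-trans (s≤s (∣p∪q∣≤∣p∣+∣q∣ p q)) (ℕ.≤-reflexive (sym (ℕ.+-suc ∣ p ∣ ∣ q ∣)))
∣p∪q∣≤∣p∣+∣q∣ (outside ∷ p) (outside ∷ q) = ∣p∪q∣≤∣p∣+∣q∣ p q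

∣⁅x⁆∪p∣≤1+∣p∣ : ∀ {n} (x : Fin n) p → ∣ ⁅ x ⁆ ∪ p ∣ ≤ suc ∣ p ∣
∣⁅x⁆∪p∣≤1+∣p∣ x p = subst (λ m → ∣ ⁅ x ⁆ ∪ p ∣ ≤ m + ∣ p ∣) (∣⁅x⁆∣≡1 x) (∣p∪q∣≤∣p∣+∣q∣ ⁅ x ⁆ p)

-- Sets of listed vertices, and paths that leave a set.

module _ {N : ℕ} where

  fromList : List (Fin N) → Subset N
  fromList xs = ⋃ (map ⁅_⁆ xs)

  -- Only an inequality: repeated entries merge in the set.
  ∣fromList∣≤length : ∀ xs → ∣ fromList xs ∣ ≤ length xs
  ∣fromList∣≤length []       = ℕ.≤-reflexive (∣⊥∣≡0 N)
  ∣fromList∣≤length (x ∷ xs) =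
    ℕ.≤-trans (∣⁅x⁆∪p∣≤1+∣p∣ x (fromList xs)) (s≤s (∣fromList∣≤length xs))

  ∈-fromList⁺ : ∀ {x xs} → x ∈ᴸ xs → x ∈ fromList xs
  ∈-fromList⁺ {x} (here ≡.refl)   = x∈p∪q⁺ (inj₁ (x∈⁅x⁆ x))
  ∈-fromList⁺     (there x∈xs) = x∈p∪q⁺ (inj₂ (∈-fromList⁺ x∈xs))

  ∈-fromList⁻ : ∀ {x} xs → x ∈ fromList xs → x ∈ᴸ xs
  ∈-fromList⁻ []       x∈ = contradiction x∈ ∉⊥
  ∈-fromList⁻ (y ∷ xs) x∈ with x∈p∪q⁻ ⁅ y ⁆ (fromList xs) x∈
  ... | inj₁ x∈⁅y⁆ = here (x∈⁅y⁆⇒x≡y y x∈⁅y⁆)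
  ... | inj₂ x∈xs  = there (∈-fromList⁻ xs x∈xs)

  ∈-pairs : ∀ {e} → e ∈ᴸ pairs {N}
  ∈-pairs {u , v} = ∈-cartesianProduct⁺ (∈-allFin u) (∈-allFin v)

  pairs-unique : Unique (pairs {N})
  pairs-unique = Unique.cartesianProduct⁺ (Unique.allFin⁺ N) (Unique.allFin⁺ N)

  -- Follow the path to its first step out of `A`; membership is decidable, so the step can be
  -- found.
  star-crosses : ∀ {R : Fin N → Fin N → Set} {A u v} → u ∈ A → v ∉ A → Star R u v →
                 ∃₂ λ x y → x ∈ A × y ∉ A × R x y
  star-crosses u∈A v∉A ε = contradiction u∈A v∉A
  star-crosses {A = A} {u} u∈A v∉A (_◅_ {j = y} r rs) with y ∈? A
  ... | yes y∈A = star-crosses y∈A v∉A rs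
  ... | no  y∉A = u , y , u∈A , y∉A , r

  -- Cut edges and cut weights.

  -- This is the list summed by `cutWeight`, named so that it can be counted. Its pairs run from `A`
  -- to `B`, whereas `edges` puts the smaller endpoint first.
  cutEdges : Graph N → Subset N → Subset N → List (Fin N × Fin N)
  cutEdges H A B = filter (λ (u , v) → (u ∈? A) ×-dec (v ∈? B) ×-dec adj? H u v) pairs

  ∈-cutEdges⁺ : ∀ H {A B u v} → u ∈ A → v ∈ B → Adj H u v → (u , v) ∈ᴸ cutEdges H A B
  ∈-cutEdges⁺ H {A} {B} u∈A v∈B uv =
    ∈-filter⁺ (λ (u , v) → (u ∈? A) ×-dec (v ∈? B) ×-dec adj? H u v) ∈-pairs (u∈A , v∈B , uv)

  ∈-cutEdges⁻ : ∀ H A B {u v} → (u , v) ∈ᴸ cutEdges H A B → u ∈ A × v ∈ B × Adj H u v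
  ∈-cutEdges⁻ H A B e∈ =
    proj₂ (∈-filter⁻ (λ (u , v) → (u ∈? A) ×-dec (v ∈? B) ×-dec adj? H u v) {xs = pairs} e∈)

  cutEdges-unique : ∀ H A B → Unique (cutEdges H A B)
  cutEdges-unique H A B =
    Unique.filter⁺ (λ (u , v) → (u ∈? A) ×-dec (v ∈? B) ×-dec adj? H u v) pairs-unique

  -- Both lists filter `pairs`, so the stronger condition gives a sublist; the additional terms are
  -- weights of edges of `G`.
  cutWeight-mono : ∀ {G H w A B A′ B′} → IsWeighting G w → (∀ {u v} → Adj H u v → Adj G u v) →
                   A ⊆ A′ → B ⊆ B′ → cutWeight H w A B ≤ℝ cutWeight G w A′ B′
  cutWeight-mono {G} {H} {w} {A} {B} {A′} {B′} isW H⊑G A⊆A′ B⊆B′ = sumOf-sublist (uncurry w)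
    (Sublist.filter⁺
      (λ (u , v) → (u ∈? A)  ×-dec (v ∈? B)  ×-dec adj? H u v)
      (λ (u , v) → (u ∈? A′) ×-dec (v ∈? B′) ×-dec adj? G u v)
      (λ { ≡.refl (u∈A , v∈B , uv) → A⊆A′ u∈A , B⊆B′ v∈B , H⊑G uv })
      (⊆-refl {x = pairs}))
    (λ e∈ → IsWeighting.w-nneg isW (proj₂ (proj₂ (∈-cutEdges⁻ G A′ B′ e∈))))

  -- Cut edges in the form used by `edges`.

  orient : Fin N × Fin N → Fin N × Fin N
  orient (u , v) with u Fin.<? v
  ... | yes _ = u , v
  ... | no  _ = v , u

  orient-∈-edges : ∀ H {u v} → Adj H u v → orient (u , v) ∈ᴸ edges H
  orient-∈-edges H {u} {v} uv with u Fin.<? v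
  ... | yes u<v = ∈-filter⁺ (λ (u , v) → (u Fin.<? v) ×-dec adj? H u v) ∈-pairs (u<v , uv)
  ... | no  u≮v with Fin.<-cmp u v
  ...   | tri< u<v _ _      = contradiction u<v u≮v
  ...   | tri≈ _ ≡.refl _   = contradiction uv (irrefl H)
  ...   | tri> _ _ v<u      =
    ∈-filter⁺ (λ (u , v) → (u Fin.<? v) ×-dec adj? H u v) ∈-pairs (v<u , symm H uv)

  orient-cases : ∀ u v → orient (u , v) ≡ (u , v) ⊎ orient (u , v) ≡ (v , u)
  orient-cases u v with u Fin.<? v
  ... | yes _ = inj₁ ≡.refl
  ... | no  _ = inj₂ ≡.refl

  -- Weights are symmetric up to `≈ℝ` rather than `≡`, so a reversed edge gets its inequality from
  -- `w-sym`.
  orient-weight : ∀ {G w u v} → IsWeighting G w → Adj G u v →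
                  uncurry w (orient (u , v)) ≤ℝ w u v × 0ℝ ≤ℝ uncurry w (orient (u , v))
  orient-weight {G} {w} {u} {v} isW uv = go (orient (u , v)) (orient-cases u v)
    where
    open IsWeighting isW
    go : ∀ e → e ≡ (u , v) ⊎ e ≡ (v , u) → uncurry w e ≤ℝ w u v × 0ℝ ≤ℝ uncurry w e
    go _ (inj₁ ≡.refl) = ≤ℝ-refl {w u v} , w-nneg uv
    go _ (inj₂ ≡.refl) = proj₂ (w-sym uv) , w-nneg (symm G uv)

  orient-cutEdges-unique : ∀ H A B → Disjoint A B → Unique (map orient (cutEdges H A B))
  orient-cutEdges-unique H A B A∩B≡∅ =
    Unique.map⁻ {f = turn} (subst Unique (sym eq) (cutEdges-unique H A B))
    where
    -- Since A and B are disjoint, turn undoes orient on the cut edges, so orient is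
    -- injective there.
    turn : Fin N × Fin N → Fin N × Fin N
    turn (u , v) = if does (u ∈? A) then (u , v) else (v , u)

    turn-orient : ∀ {e} → e ∈ᴸ cutEdges H A B → turn (orient e) ≡ e
    turn-orient {u , v} e∈ with ∈-cutEdges⁻ H A B e∈
    ... | u∈A , v∈B , _ with u Fin.<? v
    ...   | yes _ with u ∈? A
    ...     | yes _  = ≡.refl
    ...     | no u∉A = contradiction u∈A u∉A
    turn-orient {u , v} e∈ | u∈A , v∈B , _ | no _ with v ∈? A
    ...     | yes v∈A = contradiction (v , x∈p∩q⁺ (v∈A , v∈B)) A∩B≡∅
    ...     | no _    = ≡.refl

    eq : map turn (map orient (cutEdges H A B)) ≡ cutEdges H A B
    eq = ≡.trans (sym (map-∘ (cutEdges H A B))) (map-id-local (All.tabulate turn-orient))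

  -- Cuts of `k`-connected graphs.

  -- The endpoint deleted when `a` must survive. Preferring the `A`-side means that on the `B`-side
  -- only neighbours of `a` are deleted, so a non-neighbour `b` survives too.
  avoid : Fin N → Fin N × Fin N → Fin N
  avoid a (x , y) = if does (x Fin.≟ a) then y else x

  avoid-spec : ∀ a x y → (x ≡ a × avoid a (x , y) ≡ y) ⊎ (x ≢ a × avoid a (x , y) ≡ x)
  avoid-spec a x y with x Fin.≟ a
  ... | yes x≡a = inj₁ (x≡a , ≡.refl)
  ... | no  x≢a = inj₂ (x≢a , ≡.refl)

  module _ {k : ℕ} {H : Graph N} {A B : Subset N} (kc : KConnected k H) (cut : IsCut H A B) where

    private
      A∪B≡V = proj₁ (proj₁ cut)

      A∩B≡∅ : ∀ {x} → x ∈ A → x ∉ B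
      A∩B≡∅ {x} x∈A x∈B = proj₂ (proj₁ cut) (x , x∈p∩q⁺ (x∈A , x∈B))

      A⊆V : A ⊆ V H
      A⊆V x∈A = subst (_ ∈_) A∪B≡V (x∈p∪q⁺ (inj₁ x∈A))

      B⊆V : B ⊆ V H
      B⊆V x∈B = subst (_ ∈_) A∪B≡V (x∈p∪q⁺ (inj₂ x∈B))

      V⊆A∪B : ∀ {x} → x ∈ V H → x ∈ A ⊎ x ∈ B
      V⊆A∪B x∈V = x∈p∪q⁻ A B (subst (_ ∈_) (sym A∪B≡V) x∈V)

      ends : Fin N → Subset N
      ends a = fromList (map (avoid a) (cutEdges H A B))

      ∣ends∣≤ : ∀ a → ∣ ends a ∣ ≤ length (cutEdges H A B)
      ∣ends∣≤ a = subst (∣ ends a ∣ ≤_) (length-map (avoid a) (cutEdges H A B))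
                    (∣fromList∣≤length (map (avoid a) (cutEdges H A B)))

      ∈-ends⁺ : ∀ a {x y} → x ∈ A → y ∈ B → Adj H x y → avoid a (x , y) ∈ ends a
      ∈-ends⁺ a x∈A y∈B xy = ∈-fromList⁺ (∈-map⁺ (avoid a) (∈-cutEdges⁺ H x∈A y∈B xy))

      -- An endpoint in `B` is selected only when the other end of its edge is `a`.
      ∈-ends⁻ : ∀ a {z} → z ∈ ends a → (z ∈ A × z ≢ a) ⊎ (z ∈ B × Adj H a z)
      ∈-ends⁻ a z∈ with ∈-map⁻ (avoid a) (∈-fromList⁻ (map (avoid a) (cutEdges H A B)) z∈)
      ... | (x , y) , e∈ , z≡ with ∈-cutEdges⁻ H A B e∈ | avoid-spec a x y
      ...   | _ , y∈B , xy | inj₁ (≡.refl , eq) with ≡.refl ← ≡.trans z≡ eq = inj₂ (y∈B , xy)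
      ...   | x∈A , _ , _  | inj₂ (x≢a , eq)    with ≡.refl ← ≡.trans z≡ eq = inj₁ (x∈A , x≢a)

      ends⊆V : ∀ a → ends a ⊆ V H
      ends⊆V a z∈ with ∈-ends⁻ a z∈
      ... | inj₁ (z∈A , _) = A⊆V z∈A
      ... | inj₂ (z∈B , _) = B⊆V z∈B

      -- Both `a` and `b` survive the deletion. A path joining them would leave `A` along a cut
      -- edge, but one endpoint of every cut edge has been deleted.
      separated : ∀ {a b} → a ∈ A → b ∈ B → ¬ Adj H a b → ¬ Connected (H [ ∁ (ends a) ])
      separated {a} {b} a∈A b∈B ¬ab (_ , conn)
        with star-crosses a∈A (λ b∈A → A∩B≡∅ b∈A b∈B)
               (conn (x∈p∩q⁺ (A⊆V a∈A , x∉p⇒x∈∁p a∉)) (x∈p∩q⁺ (B⊆V b∈B , x∉p⇒x∈∁p b∉)))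
        where
        a∉ : a ∉ ends a
        a∉ a∈ with ∈-ends⁻ a a∈
        ... | inj₁ (_ , a≢a) = a≢a ≡.refl
        ... | inj₂ (a∈B , _) = A∩B≡∅ a∈A a∈B
        b∉ : b ∉ ends a
        b∉ b∈ with ∈-ends⁻ a b∈
        ... | inj₁ (b∈A , _) = A∩B≡∅ b∈A b∈B
        ... | inj₂ (_ , ab)  = ¬ab ab
      ... | x , y , x∈A , y∉A , xy , x∈∁ , y∈∁ with V⊆A∪B (adj∈V H (symm H xy))
      ...   | inj₁ y∈A = y∉A y∈A
      -- Whichever endpoint `avoid` selects from this edge lies in `ends a`, although both endpoints
      -- survived.
      ...   | inj₂ y∈B with avoid-spec a x y | ∈-ends⁺ a x∈A y∈B xy
      ...     | inj₁ (_ , eq) | e∈ = x∈∁p⇒x∉p y∈∁ (subst (_∈ ends a) eq e∈)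
      ...     | inj₂ (_ , eq) | e∈ = x∈∁p⇒x∉p x∈∁ (subst (_∈ ends a) eq e∈)

      -- A vertex of `A` other than `a` is selected from its edge to `b`, and a vertex of `B` from
      -- its edge to `a`.
      ends-exhaust : ∀ {a b} → a ∈ A → b ∈ B → (∀ {x y} → x ∈ A → y ∈ B → Adj H x y) →
                     V H ⊆ ⁅ a ⁆ ∪ ends a
      ends-exhaust {a} {b} a∈A b∈B complete {v} v∈V with v Fin.≟ a | V⊆A∪B v∈V
      ... | yes ≡.refl | _ = x∈p∪q⁺ (inj₁ (x∈⁅x⁆ v))
      ... | no v≢a | inj₁ v∈A with avoid-spec a v b | ∈-ends⁺ a v∈A b∈B (complete v∈A b∈B)
      ...   | inj₁ (v≡a , _) | _  = contradiction v≡a v≢a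
      ...   | inj₂ (_ , eq)  | e∈ = x∈p∪q⁺ (inj₂ (subst (_∈ ends a) eq e∈))
      ends-exhaust {a} {b} a∈A b∈B complete {v} v∈V | no v≢a | inj₂ v∈B
        with avoid-spec a a v | ∈-ends⁺ a a∈A v∈B (complete a∈A v∈B)
      ...   | inj₁ (_ , eq)  | e∈ = x∈p∪q⁺ (inj₂ (subst (_∈ ends a) eq e∈))
      ...   | inj₂ (a≢a , _) | _  = contradiction ≡.refl a≢a

    k≤∣cutEdges∣ : k ≤ length (cutEdges H A B)
    k≤∣cutEdges∣ with Fin.any? (λ x → Fin.any? (λ y → (x ∈? A) ×-dec (y ∈? B) ×-dec ¬? (adj? H x y)))
    -- With fewer than `k` cut edges, `ends a` would be small enough for `k`-connectedness to apply.
    ... | yes (a , b , a∈A , b∈B , ¬ab) = ℕ.≮⇒≥ λ cut<k →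
      separated a∈A b∈B ¬ab (proj₂ kc (ends a) (ends⊆V a) (ℕ.≤-<-trans (∣ends∣≤ a) cut<k))
    ... | no ¬∃ with proj₂ cut
    ...   | (a , a∈A) , (b , b∈B) = ℕ.≤-pred (begin
      -- A `k`-connected graph has at least `k + 1` vertices; the extra one is matched by `a`
      -- itself.
      suc k                          ≤⟨ proj₁ kc ⟩
      ∣ V H ∣                        ≤⟨ p⊆q⇒∣p∣≤∣q∣ (ends-exhaust a∈A b∈B complete) ⟩
      ∣ ⁅ a ⁆ ∪ ends a ∣             ≤⟨ ∣⁅x⁆∪p∣≤1+∣p∣ a (ends a) ⟩
      suc ∣ ends a ∣                 ≤⟨ s≤s (∣ends∣≤ a) ⟩
      suc (length (cutEdges H A B))  ∎)
      where
      open ℕ.≤-Reasoning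
      complete : ∀ {x y} → x ∈ A → y ∈ B → Adj H x y
      complete {x} {y} x∈A y∈B with adj? H x y
      ... | yes xy = xy
      ... | no ¬xy = contradiction (x , y , x∈A , y∈B , ¬xy) ¬∃

  -- The `k` lightest edges against a cut.

  -- The oriented cut edges are distinct members of `edges H`, at least `k` in number, so the
  -- exchange argument applies to them; orienting preserves weights up to `≈ℝ`.
  lightest≤cutWeight : ∀ {G H w A B k C} → IsWeighting G w → (∀ {u v} → Adj H u v → Adj G u v) →
                       KConnected k H → IsCut H A B → IsSumOfLightest k H w C →
                       C ≤ℝ cutWeight H w A B
  lightest≤cutWeight {G} {H} {w} {A} {B} {k} {C} isW H⊑G kc cut
    (light , rest , light++rest↭ , len , ord , C≤ , _) =
    ≤ℝ-trans {C} {sumOf f light} {sumOf f D} C≤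
      (≤ℝ-trans {sumOf f light} {sumOf f (map orient D)} {sumOf f D}
        (lightest≤ (Product.≡-dec Fin._≟_ Fin._≟_) f light
          (orient-cutEdges-unique H A B (proj₂ (proj₁ cut)))
          (λ e∈ → ∈-resp-↭ (↭-sym light++rest↭) (oriented∈edges e∈))
          (begin
            length light          ≡⟨ len ⟩
            k                     ≤⟨ k≤∣cutEdges∣ {H = H} kc cut ⟩
            length D              ≡⟨ length-map orient D ⟨
            length (map orient D) ∎)
          ord
          0≤oriented)
        (subst (_≤ℝ sumOf f D) (cong sumℝ (map-∘ D))
          (sumOf-mono {f = f ∘ orient} {f} D
            (λ e∈ → proj₁ (orient-weight isW (H⊑G (adjacent e∈)))))))
    where
    open ℕ.≤-Reasoning
    f = uncurry w
    D = cutEdges H A B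

    adjacent : ∀ {u v} → (u , v) ∈ᴸ D → Adj H u v
    adjacent e∈ = proj₂ (proj₂ (∈-cutEdges⁻ H A B e∈))

    oriented∈edges : ∀ {e} → e ∈ᴸ map orient D → e ∈ᴸ edges H
    oriented∈edges e∈ with ∈-map⁻ orient e∈
    ... | _ , d∈ , ≡.refl = orient-∈-edges H (adjacent d∈)

    0≤oriented : ∀ {e} → e ∈ᴸ map orient D → 0ℝ ≤ℝ f e
    0≤oriented e∈ = let _ , d∈ , e≡ = ∈-map⁻ orient e∈ in
      subst (λ e → 0ℝ ≤ℝ f e) (sym e≡) (proj₂ (orient-weight isW (H⊑G (adjacent d∈))))

  -- Cuts induced on a large subgraph.

  -- If `W` missed `P` it would fit inside the smaller set `Q`.
  meets : ∀ {W P Q : Subset N} → W ⊆ P ∪ Q → ∣ Q ∣ < ∣ W ∣ → Nonempty (W ∩ P)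
  meets {W} {P} {Q} W⊆ ∣Q∣<∣W∣ with nonempty? (W ∩ P)
  ... | yes ne = ne
  ... | no  ¬ne = contradiction (p⊆q⇒∣p∣≤∣q∣ W⊆Q) (ℕ.<⇒≱ ∣Q∣<∣W∣)
    where
    W⊆Q : W ⊆ Q
    W⊆Q {x} x∈W with x∈p∪q⁻ P Q (W⊆ x∈W)
    ... | inj₁ x∈P = contradiction (x , x∈p∩q⁺ (x∈W , x∈P)) ¬ne
    ... | inj₂ x∈Q = x∈Q

  inducedCut : ∀ {H : Graph N} {P Q} → V H ⊆ P ∪ Q → Disjoint P Q →
               ∣ P ∣ < ∣ V H ∣ → ∣ Q ∣ < ∣ V H ∣ → IsCut H (V H ∩ P) (V H ∩ Q)
  inducedCut {H} {P} {Q} V⊆ P∩Q≡∅ ∣P∣< ∣Q∣< =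
    (≡.trans (sym (∩-distribˡ-∪ (V H) P Q)) (⊆-antisym (p∩q⊆p _ _) λ x∈V → x∈p∩q⁺ (x∈V , V⊆ x∈V))
    , λ (x , x∈) → let x∈P , x∈Q = x∈p∩q⁻ (V H ∩ P) (V H ∩ Q) x∈ in
        P∩Q≡∅ (x , x∈p∩q⁺ (p∩q⊆q (V H) P x∈P , p∩q⊆q (V H) Q x∈Q)))
    -- The bounds act crosswise: the size of `Q` forces a vertex in `P`, and the size of `P` one in
    -- `Q`.
    , meets {W = V H} {P} {Q} V⊆ ∣Q∣<
    , meets {W = V H} {Q} {P} (λ x∈V → subst (_ ∈_) (∪-comm P Q) (V⊆ x∈V)) ∣P∣<

-- The lower bound for both choices of `C`.

proposition3 :
    ∀ {N : ℕ} (G : Graph N) (w : Weight) → IsWeighting G w →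
    ∀ (s₀ s₁ : ℕ) → 0 < s₀ → 0 < s₁ → s₀ + s₁ ≡ ∣ V G ∣ →
    ∀ (U₀ U₁ : Subset N) → IsSubproblem G s₀ s₁ U₀ U₁ →
    let F  = V G ─ (U₀ ∪ U₁)
        f₀ = s₀ ∸ ∣ U₀ ∣
        f₁ = s₁ ∸ ∣ U₁ ∣
        G′ = G [ F ]
    in f₁ ≤ f₀ →
    ∀ (C : ℝ) →
    (∃[ k ] (1 ≤ k × ∃[ H ] (IsKComponent k H G′ × f₀ < ∣ V H ∣ × IsSumOfLightest k H w C)))
      ⊎ (∃[ H ] (IsComponent H G′ × f₀ < ∣ V H ∣ × IsMinCutValue H w C)) →
    ∀ (V₀ V₁ : Subset N) → IsCompletion G s₀ s₁ U₀ U₁ V₀ V₁ →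
    C ≤ℝ cutWeight G w (V₀ ─ U₀) (V₁ ─ U₁)
proposition3 {N} G w isW s₀ s₁ _ _ _ U₀ U₁ _ f₁≤f₀ C bound V₀ V₁ comp =
  [ (λ (k , _ , H , (H⊑G′ , kc , _) , f₀< , lightest) → via {H} H⊑G′
      (lightest≤cutWeight {G = G} {H} {w} {C = C} isW (proj₁ ∘ proj₂ H⊑G′) kc
        (cutOf {H} H⊑G′ f₀<) lightest))
  -- A minimum cut value is at most the weight of the cut that the completion induces on `H`.
  , (λ (H , (H⊑G′ , _) , f₀< , _ , minimal) → via {H} H⊑G′
      (minimal (V H ∩ W₀) (V H ∩ W₁) (cutOf {H} H⊑G′ f₀<)))
  ]′ bound
  where
  open IsCompletion comp
  F  = V G ─ (U₀ ∪ U₁)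
  W₀ = V₀ ─ U₀
  W₁ = V₁ ─ U₁

  ∣W₀∣≡f₀ : ∣ W₀ ∣ ≡ s₀ ∸ ∣ U₀ ∣
  ∣W₀∣≡f₀ = ≡.trans (q⊆p⇒∣p─q∣≡∣p∣∸∣q∣ V₀ U₀ U₀⊆V₀) (cong (_∸ ∣ U₀ ∣) ∣V₀∣≡s₀)

  ∣W₁∣≡f₁ : ∣ W₁ ∣ ≡ s₁ ∸ ∣ U₁ ∣
  ∣W₁∣≡f₁ = ≡.trans (q⊆p⇒∣p─q∣≡∣p∣∸∣q∣ V₁ U₁ U₁⊆V₁) (cong (_∸ ∣ U₁ ∣) ∣V₁∣≡s₁)

  F⊆W₀∪W₁ : F ⊆ W₀ ∪ W₁
  F⊆W₀∪W₁ {x} x∈F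
    with x∈p─q⇒x∉q (V G) (U₀ ∪ U₁) x∈F
       | x∈p∪q⁻ V₀ V₁ (subst (x ∈_) (sym (proj₁ partition)) (p─q⊆p (V G) (U₀ ∪ U₁) x∈F))
  ... | x∉U | inj₁ x∈V₀ = x∈p∪q⁺ (inj₁ (x∈p∧x∉q⇒x∈p─q x∈V₀ (x∉U ∘ x∈p∪q⁺ ∘ inj₁)))
  ... | x∉U | inj₂ x∈V₁ = x∈p∪q⁺ (inj₂ (x∈p∧x∉q⇒x∈p─q x∈V₁ (x∉U ∘ x∈p∪q⁺ ∘ inj₂)))

  W₀∩W₁≡∅ : Disjoint W₀ W₁
  W₀∩W₁≡∅ (x , x∈) = let x∈W₀ , x∈W₁ = x∈p∩q⁻ W₀ W₁ x∈ in
    proj₂ partition (x , x∈p∩q⁺ (p─q⊆p V₀ U₀ x∈W₀ , p─q⊆p V₁ U₁ x∈W₁))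

  -- The sides have `f₀` and `f₁` vertices, and `f₁ ≤ f₀` lets the single bound on `H` exceed both.
  cutOf : ∀ {H} → H ⊑ G [ F ] → s₀ ∸ ∣ U₀ ∣ < ∣ V H ∣ → IsCut H (V H ∩ W₀) (V H ∩ W₁)
  cutOf {H} (VH⊆ , _) f₀< = inducedCut {H = H} (F⊆W₀∪W₁ ∘ p∩q⊆q (V G) F ∘ VH⊆) W₀∩W₁≡∅
    (subst (_< ∣ V H ∣) (sym ∣W₀∣≡f₀) f₀<)
    (subst (_< ∣ V H ∣) (sym ∣W₁∣≡f₁) (ℕ.≤-<-trans f₁≤f₀ f₀<))

  -- Every edge of the induced cut of `H` is also an edge of `G` between `W₀` and `W₁`, so passing
  -- to `G` can only add weight.
  via : ∀ {H} → H ⊑ G [ F ] → C ≤ℝ cutWeight H w (V H ∩ W₀) (V H ∩ W₁) →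
        C ≤ℝ cutWeight G w W₀ W₁
  via {H} (_ , adj⊆) C≤ =
    ≤ℝ-trans {C} {cutWeight H w (V H ∩ W₀) (V H ∩ W₁)} {cutWeight G w W₀ W₁} C≤
      (cutWeight-mono {G = G} {H} {w} isW (proj₁ ∘ adj⊆) (p∩q⊆q (V H) W₀) (p∩q⊆q (V H) W₁))
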